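{- Let $n, k, r$ be integers with $0\le k\le n-2$ and $r\ge 1$. Then $$\frac{k+1}{n-k-1}\sum_i\binom{k}{i}\binom{n-k+i-1}{r}\binom{n-i-1}{n-r}=\frac{k+1}{r}\sum_{0\le j\le k/2}(-1)^j\,\frac{\binom{k}{j}\binom{k-j}{j}\binom{n-j-2}{r-1}\binom{n-j-1}{r-j-1}}{\binom{n-j-2}{j}}.$$
   Context: Binomial coefficients $\binom{a}{b}$ with $a$ a nonnegative integer are $0$ when $b<0$ or $b>a$; the left sum is over all integers $i$. -}

module Defs where

open import Data.Nat as ℕ using (ℕ; zero; suc)
open import Data.Nat.Combinatorics using (_C_)
open import Data.Integer as ℤ using (ℤ; +_; -[1+_])
open import Data.Rational as ℚ using (ℚ; 0ℚ; _÷_; ≢-nonZero)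
open import Data.Rational.Properties using (_≟_)
open import Relation.Nullary using (yes; no)

ℕ→ℚ : ℕ → ℚ
ℕ→ℚ m = (+ m) ℚ./ 1

-- binomial coefficient with nonnegative integer top a and arbitrary
-- integer bottom b: zero when b < 0 (and, via _C_, when b > a)
binom : ℕ → ℤ → ℚ
binom a (+ b)    = ℕ→ℚ (a C b)
binom a -[1+ _ ] = 0ℚ

-- total division on ℚ (x / 0 := 0); only ever applied to nonzero
-- denominators in the theorem, under its hypotheses
_÷'_ : ℚ → ℚ → ℚ
p ÷' q with q ≟ 0ℚ
... | yes _  = 0ℚ
... | no q≢0 = _÷_ p q {{≢-nonZero q≢0}}

sgn : ℕ → ℚ
sgn j = (ℤ.-[1+ 0 ] ℤ.^ j) ℚ./ 1

sumTo : ℕ → (ℕ → ℚ) → ℚ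
sumTo zero    f = f 0
sumTo (suc m) f = sumTo m f ℚ.+ f (suc m)

{-# OPTIONS --safe #-}
-- Put n = k + 1 + m and r = s + 1. Clearing factorials, the claim becomes
--   Σᵢ C(s,i) C(k−i+m,m) C(m+i,s+1) = Σⱼ (−1)ʲ C(s,j) C(k−2j+m−1,m−1) C(k+m−j,s+1),
-- whose sides are the coefficients of xᵏ yˢ⁺¹ in
--   A = (1−x)⁻ᵐ⁻¹ (1+y)ᵐ (1 + x(1+y))ˢ   and   B = (1+y)ᵐ (1 − x(1+y))⁻ᵐ (1 − x²(1+y))ˢ.
-- Lagrange inversion (y = w (1+x+xy), respectively y = w (1−x²−x²y)) turns both into the
-- coefficient of xᵏ wˢ⁺¹ in ((1+w) / ((1−x)(1−xw)))ᵐ / (1−x²). Multiplying the m+1 instance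
-- by (1−x)(1−xw) suggests the recurrence
--   (1−x) Aₘ₊₁,ₛ₊₁ = Aₘ,ₛ₊₁ + Aₘ,ₛ + x (1−x) Aₘ₊₁,ₛ,
-- which A and B are each shown to satisfy by Pascal-type manipulations, so no inversion is needed.
module Submission where

open import Defs
open import Data.Nat using (ℕ; _+_; _∸_; _≤_; ⌊_/2⌋)
open import Data.Integer using (+_) renaming (_-_ to _-ℤ_)
open import Data.Rational using (ℚ) renaming (_*_ to _*ℚ_)
open import Relation.Binary.PropositionalEquality using (_≡_)

open import Data.Nat as ℕ using (zero; suc; _*_; _<_; _!)
import Data.Nat.Properties as ℕ
import Data.Nat.Tactic.RingSolver as ℕ-Solver
open import Data.Nat.DivMod using (m/n*n≡m)
open import Data.Nat.Combinatorics
  using (_C_; nCk+nC[k+1]≡[n+1]C[k+1]; nCn≡1; k>n⇒nCk≡0; nCk≡n!/k![n-k]!; k![n∸k]!∣n!)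
open import Data.Integer as ℤ using (-[1+_])
import Data.Integer.Properties as ℤ
import Data.Integer.Tactic.RingSolver as ℤ-Solver
open import Data.Rational as ℚ using (0ℚ; 1ℚ; _-_; -_; toℚᵘ; ≢-nonZero) renaming (_+_ to _+ℚ_)
open import Data.Rational.Properties
open import Data.Rational.Unnormalised as ℚᵘ using (mkℚᵘ; *≡*)
import Data.Rational.Unnormalised.Properties as ℚᵘ
open import Data.Maybe.Base using (just; nothing)
open import Data.Product using (_,_)
open import Data.Sum using ([_,_]′)
open import Level using (0ℓ)
open import Algebra.Bundles using (CommutativeMonoid)
open import Algebra.Properties.Group +-0-group using (⁻¹-involutive)
open import Algebra.Properties.CommutativeSemigroup
  (CommutativeMonoid.commutativeSemigroup +-0-commutativeMonoid) renaming (interchange to +-interchange)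
open import Relation.Nullary using (yes; no; contradiction)
open import Relation.Binary.PropositionalEquality hiding (J)
open import Tactic.RingSolver using (solve-∀)
import Tactic.RingSolver.Core.AlmostCommutativeRing as ACR

open ≡-Reasoning

-- Arithmetic in ℚ of naturals, signs and binomial coefficients.

ℚ-ring : ACR.AlmostCommutativeRing 0ℓ 0ℓ
ℚ-ring = ACR.fromCommutativeRing +-*-commutativeRing isZero
  where
  isZero : ∀ p → _
  isZero p with 0ℚ ≟ p
  ... | yes 0≡p = just 0≡p
  ... | no _    = nothing

ℕ→ℚ-+ : ∀ a b → ℕ→ℚ (a + b) ≡ ℕ→ℚ a +ℚ ℕ→ℚ b
ℕ→ℚ-+ a b = toℚᵘ-injective (begin′
  toℚᵘ (ℕ→ℚ (a + b)) ≈⟨ toℚᵘ-fromℚᵘ (mkℚᵘ (ℤ.+ (a + b)) 0) ⟩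
  mkℚᵘ (ℤ.+ (a + b)) 0
    ≈⟨ *≡* (cong (ℤ._* (ℤ.+ 1)) (trans (ℤ.pos-+ a b)
         (cong₂ ℤ._+_ (sym (ℤ.*-identityʳ (ℤ.+ a))) (sym (ℤ.*-identityʳ (ℤ.+ b)))))) ⟩
  mkℚᵘ (ℤ.+ a) 0 ℚᵘ.+ mkℚᵘ (ℤ.+ b) 0 ≈⟨ ℚᵘ.+-cong (toℚᵘ-fromℚᵘ (mkℚᵘ (ℤ.+ a) 0)) (toℚᵘ-fromℚᵘ (mkℚᵘ (ℤ.+ b) 0)) ⟨
  toℚᵘ (ℕ→ℚ a) ℚᵘ.+ toℚᵘ (ℕ→ℚ b) ≈⟨ toℚᵘ-homo-+ (ℕ→ℚ a) (ℕ→ℚ b) ⟨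
  toℚᵘ (ℕ→ℚ a +ℚ ℕ→ℚ b) ∎′)
  where open ℚᵘ.≃-Reasoning renaming (begin_ to begin′_; _∎ to _∎′)

ℕ→ℚ-* : ∀ a b → ℕ→ℚ (a * b) ≡ ℕ→ℚ a *ℚ ℕ→ℚ b
ℕ→ℚ-* a b = toℚᵘ-injective (begin′
  toℚᵘ (ℕ→ℚ (a * b)) ≈⟨ toℚᵘ-fromℚᵘ (mkℚᵘ (ℤ.+ (a * b)) 0) ⟩
  mkℚᵘ (ℤ.+ (a * b)) 0 ≈⟨ *≡* (cong (ℤ._* (ℤ.+ 1)) (ℤ.pos-* a b)) ⟩
  mkℚᵘ (ℤ.+ a) 0 ℚᵘ.* mkℚᵘ (ℤ.+ b) 0 ≈⟨ ℚᵘ.*-cong (toℚᵘ-fromℚᵘ (mkℚᵘ (ℤ.+ a) 0)) (toℚᵘ-fromℚᵘ (mkℚᵘ (ℤ.+ b) 0)) ⟨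
  toℚᵘ (ℕ→ℚ a) ℚᵘ.* toℚᵘ (ℕ→ℚ b) ≈⟨ toℚᵘ-homo-* (ℕ→ℚ a) (ℕ→ℚ b) ⟨
  toℚᵘ (ℕ→ℚ a *ℚ ℕ→ℚ b) ∎′)
  where open ℚᵘ.≃-Reasoning renaming (begin_ to begin′_; _∎ to _∎′)

sgn-suc : ∀ j → sgn (suc j) ≡ - sgn j
sgn-suc j = trans (cong (λ z → z ℚ./ 1) (ℤ.-1*i≡-i (ℤ.-[1+ 0 ] ℤ.^ j))) (neg/1 (ℤ.-[1+ 0 ] ℤ.^ j))
  where
  neg/1 : ∀ z → (ℤ.- z) ℚ./ 1 ≡ - (z ℚ./ 1)
  neg/1 (ℤ.+ zero)  = refl
  neg/1 (ℤ.+ suc n) = refl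
  neg/1 -[1+ n ]  = sym (⁻¹-involutive (ℕ→ℚ (suc n)))

+---interchange : ∀ a b p q → (a +ℚ b) - (p +ℚ q) ≡ (a - p) +ℚ (b - q)
+---interchange = solve-∀ ℚ-ring

bin : ℕ → ℕ → ℚ
bin n k = ℕ→ℚ (n C k)

bin-pascal : ∀ n k → bin (suc n) (suc k) ≡ bin n (suc k) +ℚ bin n k
bin-pascal n k = begin
  bin (suc n) (suc k) ≡⟨ cong ℕ→ℚ (nCk+nC[k+1]≡[n+1]C[k+1] n k) ⟨
  ℕ→ℚ (n C k + n C suc k) ≡⟨ ℕ→ℚ-+ (n C k) (n C suc k) ⟩
  bin n k +ℚ bin n (suc k) ≡⟨ +-comm (bin n k) (bin n (suc k)) ⟩
  bin n (suc k) +ℚ bin n k ∎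

bin-vanish : ∀ {n k} → n < k → bin n k ≡ 0ℚ
bin-vanish n<k = cong ℕ→ℚ (k>n⇒nCk≡0 n<k)

-- Power series in one variable.

-- Power series in x are their coefficient sequences; shift is multiplication by x.
Series : Set
Series = ℕ → ℚ

shift : Series → Series
shift f zero    = 0ℚ
shift f (suc k) = f k

shift-cong : ∀ {f g} → f ≗ g → shift f ≗ shift g
shift-cong f≗g zero    = refl
shift-cong f≗g (suc k) = f≗g k

shift-+ : ∀ {f} (g h : Series) → (∀ k → f k ≡ g k +ℚ h k) → ∀ k → shift f k ≡ shift g k +ℚ shift h k
shift-+ g h f≡g+h zero    = refl
shift-+ g h f≡g+h (suc k) = f≡g+h k

shift²-+ : ∀ {f} (g h : Series) → (∀ k → f k ≡ g k +ℚ h k) →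
  ∀ k → shift (shift f) k ≡ shift (shift g) k +ℚ shift (shift h) k
shift²-+ g h f≡g+h = shift-+ (shift g) (shift h) (shift-+ g h f≡g+h)

shift-- : ∀ (g h : Series) k → shift (λ k → g k - h k) k ≡ shift g k - shift h k
shift-- g h zero    = refl
shift-- g h (suc k) = refl

shift-0 : ∀ {f} → (∀ k → f k ≡ 0ℚ) → ∀ k → shift f k ≡ 0ℚ
shift-0 f≡0 zero    = refl
shift-0 f≡0 (suc k) = f≡0 k

-- Coefficient k of f is fixed by coefficient k - 1 and p, so the factor 1 - x can be cancelled.
-- This is how `A` and `B` are identified from a recurrence for their multiples by 1 - x.
shift-fixpoint-unique : ∀ {f g p q : Series} →
  (∀ k → f k ≡ shift f k +ℚ p k) → (∀ k → g k ≡ shift g k +ℚ q k) → p ≗ q → f ≗ g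
shift-fixpoint-unique {f} {g} {p} {q} hf hg p≗q k =
  trans (hf k) (trans (cong₂ _+ℚ_ (prev k) (p≗q k)) (sym (hg k)))
  where
  prev : ∀ k → shift f k ≡ shift g k
  prev zero    = refl
  prev (suc k) = shift-fixpoint-unique hf hg p≗q k

-- The coefficients of (1 − x)⁻ᵉ.
geo : ℕ → Series
geo e       zero    = 1ℚ
geo zero    (suc k) = 0ℚ
geo (suc e) (suc k) = geo e (suc k) +ℚ geo (suc e) k

geo-suc : ∀ e k → geo (suc e) k ≡ geo e k +ℚ shift (geo (suc e)) k
geo-suc e zero    = refl
geo-suc e (suc k) = refl

geo-C : ∀ e k → geo (suc e) k ≡ bin (e + k) e
geo-C e zero = sym (cong ℕ→ℚ (trans (cong (_C e) (ℕ.+-identityʳ e)) (nCn≡1 e)))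
geo-C zero (suc k) = trans (+-identityˡ (geo 1 k)) (geo-C zero k)
geo-C (suc e) (suc k) = begin
  geo (suc e) (suc k) +ℚ geo (suc (suc e)) k ≡⟨ cong₂ _+ℚ_ (geo-C e (suc k)) (geo-C (suc e) k) ⟩
  bin (e + suc k) e +ℚ bin (suc e + k) (suc e) ≡⟨ cong (λ n → bin (e + suc k) e +ℚ bin n (suc e)) (ℕ.+-suc e k) ⟨
  bin (e + suc k) e +ℚ bin (e + suc k) (suc e) ≡⟨ +-comm (bin (e + suc k) e) _ ⟩
  bin (e + suc k) (suc e) +ℚ bin (e + suc k) e ≡⟨ bin-pascal (e + suc k) e ⟨
  bin (suc e + suc k) (suc e) ∎

-- Two families of bivariate series and their Pascal-type relations.

-- U e m s t = [yᵗ] (1 − x)⁻ᵉ (1 + y)ᵐ (1 + x (1 + y))ˢ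
U : (e m s t : ℕ) → Series
U e m zero    t k = geo e k *ℚ bin m t
U e m (suc s) t k = U e m s t k +ℚ shift (U e (suc m) s t) k

-- V e m s t = [yᵗ] (1 + y)ᵐ (1 − x (1 + y))⁻ᵉ (1 − x² (1 + y))ˢ
V : (e m s t : ℕ) → Series
V e m zero    t k = geo e k *ℚ bin (m + k) t
V e m (suc s) t k = V e m s t k - shift (shift (V e (suc m) s t)) k

-- Raising m multiplies the series by 1 + y, which adds two neighbouring y-coefficients. The same
-- holds for `V`.
U-pascal : ∀ e m s t k → U e (suc m) s (suc t) k ≡ U e m s (suc t) k +ℚ U e m s t k
U-pascal e m zero t k = trans (cong (geo e k *ℚ_) (bin-pascal m t)) (*-distribˡ-+ (geo e k) _ _)
U-pascal e m (suc s) t k =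
  trans (cong₂ _+ℚ_ (U-pascal e m s t k) (shift-+ (U e (suc m) s (suc t)) (U e (suc m) s t) (U-pascal e (suc m) s t) k))
        (+-interchange (U e m s (suc t) k) (U e m s t k) _ _)

V-pascal : ∀ e m s t k → V e (suc m) s (suc t) k ≡ V e m s (suc t) k +ℚ V e m s t k
V-pascal e m zero t k = trans (cong (geo e k *ℚ_) (bin-pascal (m + k) t)) (*-distribˡ-+ (geo e k) _ _)
V-pascal e m (suc s) t k =
  trans (cong₂ _-_ (V-pascal e m s t k)
          (shift²-+ (V e (suc m) s (suc t)) (V e (suc m) s t) (V-pascal e (suc m) s t) k))
        (+---interchange (V e m s (suc t) k) (V e m s t k) (shift (shift (V e (suc m) s (suc t))) k) _)

-- Peels off one factor: (1 - x)⁻ᵉ⁻¹ = (1 - x)⁻ᵉ + x (1 - x)⁻ᵉ⁻¹.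
U-geometric : ∀ e m s t k → U (suc e) m s t k ≡ U e m s t k +ℚ shift (U (suc e) m s t) k
U-geometric e m zero t zero = sym (+-identityʳ _)
U-geometric e m zero t (suc k) = *-distribʳ-+ (bin m t) (geo e (suc k)) (geo (suc e) k)
U-geometric e m (suc s) t k = begin
  U (suc e) m s t k +ℚ shift (U (suc e) (suc m) s t) k
    ≡⟨ cong₂ _+ℚ_ (U-geometric e m s t k)
         (shift-+ (U e (suc m) s t) (shift (U (suc e) (suc m) s t)) (U-geometric e (suc m) s t) k) ⟩
  (a +ℚ b) +ℚ (p +ℚ q)
    ≡⟨ +-interchange a b p q ⟩
  (a +ℚ p) +ℚ (b +ℚ q)
    ≡⟨ cong ((a +ℚ p) +ℚ_) (shift-+ (U (suc e) m s t) (shift (U (suc e) (suc m) s t)) (λ _ → refl) k) ⟨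
  (a +ℚ p) +ℚ shift (U (suc e) m (suc s) t) k ∎
  where
  a = U e m s t k
  b = shift (U (suc e) m s t) k
  p = shift (U e (suc m) s t) k
  q = shift (shift (U (suc e) (suc m) s t)) k

-- Here the peeled factor is 1 - x (1 + y), so the x-term carries an extra 1 + y, which raises m.
V-geometric : ∀ e m s t k → V (suc e) m s t k ≡ V e m s t k +ℚ shift (V (suc e) (suc m) s t) k
V-geometric e m zero t zero = sym (+-identityʳ _)
V-geometric e m zero t (suc k) = begin
  (geo e (suc k) +ℚ geo (suc e) k) *ℚ bin (m + suc k) t
    ≡⟨ *-distribʳ-+ (bin (m + suc k) t) (geo e (suc k)) (geo (suc e) k) ⟩
  geo e (suc k) *ℚ bin (m + suc k) t +ℚ geo (suc e) k *ℚ bin (m + suc k) t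
    ≡⟨ cong (λ n → geo e (suc k) *ℚ bin (m + suc k) t +ℚ geo (suc e) k *ℚ bin n t) (ℕ.+-suc m k) ⟩
  geo e (suc k) *ℚ bin (m + suc k) t +ℚ geo (suc e) k *ℚ bin (suc m + k) t ∎
V-geometric e m (suc s) t k = begin
  V (suc e) m s t k - shift (shift (V (suc e) (suc m) s t)) k
    ≡⟨ cong₂ _-_ (V-geometric e m s t k)
         (shift²-+ (V e (suc m) s t) (shift (V (suc e) (suc (suc m)) s t)) (V-geometric e (suc m) s t) k) ⟩
  (a +ℚ b) - (p +ℚ q)
    ≡⟨ +---interchange a b p q ⟩
  (a - p) +ℚ (b - q)
    ≡⟨ cong ((a - p) +ℚ_) (shift-- (V (suc e) (suc m) s t) _ k) ⟨
  (a - p) +ℚ shift (V (suc e) (suc m) (suc s) t) k ∎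
  where
  a = V e m s t k
  b = shift (V (suc e) (suc m) s t) k
  p = shift (shift (V e (suc m) s t)) k
  q = shift (shift (shift (V (suc e) (suc (suc m)) s t))) k

-- The factor (1 - x)⁻ᵉ is free of y, so the degree in y is at most m + s.
U-vanish : ∀ e m s t → m + s < t → ∀ k → U e m s t k ≡ 0ℚ
U-vanish e m zero t m<t k =
  trans (cong (geo e k *ℚ_) (bin-vanish (subst (ℕ._< t) (ℕ.+-identityʳ m) m<t))) (*-zeroʳ (geo e k))
U-vanish e m (suc s) t m+s<t k =
  cong₂ _+ℚ_ (U-vanish e m s t (ℕ.<-trans (ℕ.+-monoʳ-< m (ℕ.n<1+n s)) m+s<t) k)
            (shift-0 (U-vanish e (suc m) s t (subst (ℕ._< t) (ℕ.+-suc m s) m+s<t)) k)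

-- At e = 0 the factor (1 - x (1 + y))⁻ᵉ is 1; for larger e the degree in y would grow with k.
V₀-vanish : ∀ m s t → m + s < t → ∀ k → V 0 m s t k ≡ 0ℚ
V₀-vanish m zero t m<t zero = trans (*-identityˡ (bin (m + 0) t)) (bin-vanish m<t)
V₀-vanish m zero t m<t (suc k) = *-zeroˡ (bin (m + suc k) t)
V₀-vanish m (suc s) t m+s<t k =
  cong₂ _-_ (V₀-vanish m s t (ℕ.<-trans (ℕ.+-monoʳ-< m (ℕ.n<1+n s)) m+s<t) k)
            (shift-0 (shift-0 (V₀-vanish (suc m) s t (subst (ℕ._< t) (ℕ.+-suc m s) m+s<t))) k)

-- The common recurrence and the equality of the two series.

A B : (m s : ℕ) → Series
A m s = U (suc m) m s (suc s)
B m s = V m m s (suc s)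

-- What remains of (1 − x) Aₘ₊₁,ₛ − Aₘ,ₛ; unlike A at s − 1 it also makes sense for s = 0.
A-rest B-rest : (m s : ℕ) → Series
A-rest m s = U (suc m) m s s
B-rest m s k = V m m s s k +ℚ shift (V (suc m) (suc m) s s) k

-- Lowering m removes a factor (1 - x)⁻¹ by `U-geometric` and a factor 1 + y by `U-pascal`; the
-- latter leaves the y-coefficient of index s, which is `A-rest`.
A-step : ∀ m s k → A (suc m) s k ≡ shift (A (suc m) s) k +ℚ (A m s k +ℚ A-rest m s k)
A-step m s k = begin
  A (suc m) s k
    ≡⟨ U-geometric (suc m) (suc m) s (suc s) k ⟩
  U (suc m) (suc m) s (suc s) k +ℚ shift (A (suc m) s) k
    ≡⟨ +-comm _ (shift (A (suc m) s) k) ⟩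
  shift (A (suc m) s) k +ℚ U (suc m) (suc m) s (suc s) k
    ≡⟨ cong (shift (A (suc m) s) k +ℚ_) (U-pascal (suc m) m s s k) ⟩
  shift (A (suc m) s) k +ℚ (A m s k +ℚ A-rest m s k) ∎

-- `V-geometric` leaves a second term with factor x (1 + y). Applying `V-pascal` to it as well
-- yields x times `B (suc m) s`, as in `A-step`, and a y-coefficient of index s, which is the
-- shifted summand of `B-rest`.
B-step : ∀ m s k → B (suc m) s k ≡ shift (B (suc m) s) k +ℚ (B m s k +ℚ B-rest m s k)
B-step m s k = begin
  B (suc m) s k
    ≡⟨ V-geometric m (suc m) s (suc s) k ⟩
  V m (suc m) s (suc s) k +ℚ shift (V (suc m) (suc (suc m)) s (suc s)) k
    ≡⟨ cong₂ _+ℚ_ (V-pascal m m s s k) (shift-+ (B (suc m) s) (V (suc m) (suc m) s s) (V-pascal (suc m) (suc m) s s) k) ⟩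
  (B m s k +ℚ V m m s s k) +ℚ (shift (B (suc m) s) k +ℚ shift (V (suc m) (suc m) s s) k)
    ≡⟨ rearrange (B m s k) (V m m s s k) (shift (B (suc m) s) k) _ ⟩
  shift (B (suc m) s) k +ℚ (B m s k +ℚ B-rest m s k) ∎
  where
  rearrange : ∀ b v b′ v′ → (b +ℚ v) +ℚ (b′ +ℚ v′) ≡ b′ +ℚ (b +ℚ (v +ℚ v′))
  rearrange = solve-∀ ℚ-ring

-- Unfolding one factor 1 + x (1 + y) gives `A m s` plus x times a series that `U-geometric`
-- identifies as (1 - x) times `A (suc m) s`.
A-rest-suc : ∀ m s k →
  A-rest m (suc s) k ≡ A m s k +ℚ (shift (A (suc m) s) k - shift (shift (A (suc m) s)) k)
A-rest-suc m s k = cong (A m s k +ℚ_) (begin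
  u ≡⟨ rearrange u a″ ⟩
  (u +ℚ a″) - a″
    ≡⟨ cong (_- a″) (shift-+ (U (suc m) (suc m) s (suc s)) (shift (A (suc m) s)) (U-geometric (suc m) (suc m) s (suc s)) k) ⟨
  shift (A (suc m) s) k - a″ ∎)
  where
  u = shift (U (suc m) (suc m) s (suc s)) k
  a″ = shift (shift (A (suc m) s)) k
  rearrange : ∀ u a → u ≡ (u +ℚ a) - a
  rearrange = solve-∀ ℚ-ring

-- Unfolding one factor 1 - x² (1 + y) in each summand of `B-rest` produces two subtracted terms,
-- which `V-geometric` merges into x² times `B (suc m) s`.
B-rest-suc : ∀ m s k →
  B-rest m (suc s) k ≡ B m s k +ℚ (shift (B (suc m) s) k - shift (shift (B (suc m) s)) k)
B-rest-suc m s k = begin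
  (B m s k - p) +ℚ shift (V (suc m) (suc m) (suc s) (suc s)) k
    ≡⟨ cong ((B m s k - p) +ℚ_) (shift-- (B (suc m) s) _ k) ⟩
  (B m s k - p) +ℚ (b′ - q)
    ≡⟨ rearrange (B m s k) p b′ q ⟩
  B m s k +ℚ (b′ - (p +ℚ q))
    ≡⟨ cong (λ z → B m s k +ℚ (b′ - z))
         (shift²-+ (V m (suc m) s (suc s)) (shift (V (suc m) (suc (suc m)) s (suc s))) (V-geometric m (suc m) s (suc s)) k) ⟨
  B m s k +ℚ (b′ - shift (shift (B (suc m) s)) k) ∎
  where
  b′ = shift (B (suc m) s) k
  p = shift (shift (V m (suc m) s (suc s))) k
  q = shift (shift (shift (V (suc m) (suc (suc m)) s (suc s)))) k
  rearrange : ∀ b p b′ q → (b - p) +ℚ (b′ - q) ≡ b +ℚ (b′ - (p +ℚ q))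
  rearrange = solve-∀ ℚ-ring

-- For s = 0 only the constant y-coefficient is taken, and both sides are (1 - x)⁻ᵐ⁻¹.
rest₀ : ∀ m k → A-rest m 0 k ≡ B-rest m 0 k
rest₀ m k = begin
  geo (suc m) k *ℚ 1ℚ ≡⟨ *-identityʳ _ ⟩
  geo (suc m) k ≡⟨ geo-suc m k ⟩
  geo m k +ℚ shift (geo (suc m)) k
    ≡⟨ cong₂ _+ℚ_ (sym (*-identityʳ (geo m k))) (shift-cong (λ j → sym (*-identityʳ (geo (suc m) j))) k) ⟩
  B-rest m 0 k ∎

-- Induction on m and, inside it, on s: the instance `suc m` at s needs the rests at s, which in
-- turn need the instances m and `suc m` at s - 1.
A≗B : ∀ m s → A m s ≗ B m s
-- For m = 0 both series have degree at most s in y, while the coefficient taken has index s + 1.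
A≗B zero s k =
  trans (U-vanish 1 0 s (suc s) (ℕ.n<1+n s) k) (sym (V₀-vanish 0 s (suc s) (ℕ.n<1+n s) k))
A≗B (suc m) s =
  shift-fixpoint-unique (A-step m s) (B-step m s) (λ k → cong₂ _+ℚ_ (A≗B m s k) (rest s k))
  where
  rest : ∀ s k → A-rest m s k ≡ B-rest m s k
  rest zero k = rest₀ m k
  rest (suc s) k = begin
    A-rest m (suc s) k ≡⟨ A-rest-suc m s k ⟩
    A m s k +ℚ (shift (A (suc m) s) k - shift (shift (A (suc m) s)) k)
      ≡⟨ cong₂ _+ℚ_ (A≗B m s k)
           (cong₂ _-_ (shift-cong (A≗B (suc m) s) k) (shift-cong (shift-cong (A≗B (suc m) s)) k)) ⟩
    B m s k +ℚ (shift (B (suc m) s) k - shift (shift (B (suc m) s)) k) ≡⟨ B-rest-suc m s k ⟨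
    B-rest m (suc s) k ∎

-- Finite sums and explicit coefficients.

sumTo-cong : ∀ N {f g : ℕ → ℚ} → (∀ i → i ≤ N → f i ≡ g i) → sumTo N f ≡ sumTo N g
sumTo-cong zero    h = h 0 ℕ.z≤n
sumTo-cong (suc N) h =
  cong₂ _+ℚ_ (sumTo-cong N (λ i i≤N → h i (ℕ.m≤n⇒m≤1+n i≤N))) (h (suc N) ℕ.≤-refl)

sumTo-head : ∀ N (f : ℕ → ℚ) → sumTo (suc N) f ≡ f 0 +ℚ sumTo N (λ i → f (suc i))
sumTo-head zero    f = refl
sumTo-head (suc N) f =
  trans (cong (_+ℚ f (suc (suc N))) (sumTo-head N f)) (+-assoc (f 0) _ _)

sumTo-+ : ∀ N (f g : ℕ → ℚ) → sumTo N (λ i → f i +ℚ g i) ≡ sumTo N f +ℚ sumTo N g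
sumTo-+ zero    f g = refl
sumTo-+ (suc N) f g = trans (cong (_+ℚ (f (suc N) +ℚ g (suc N))) (sumTo-+ N f g)) (+-interchange (sumTo N f) _ _ _)

*-sumTo : ∀ N a (f : ℕ → ℚ) → a *ℚ sumTo N f ≡ sumTo N (λ i → a *ℚ f i)
*-sumTo zero    a f = refl
*-sumTo (suc N) a f =
  trans (*-distribˡ-+ a (sumTo N f) (f (suc N))) (cong (_+ℚ a *ℚ f (suc N)) (*-sumTo N a f))

binomialSum : (s N : ℕ) → (ℕ → ℚ) → ℚ
binomialSum s N h = sumTo N (λ j → bin s j *ℚ h j)

binomialSum₀ : ∀ N h → binomialSum 0 N h ≡ h 0
binomialSum₀ zero    h = *-identityˡ (h 0)
binomialSum₀ (suc N) h =
  trans (cong₂ _+ℚ_ (binomialSum₀ N h) (*-zeroˡ (h (suc N)))) (+-identityʳ (h 0))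

-- Pascal's rule on the terms with j ≥ 1. The bound is independent of s because the sums below are
-- cut off by the power of x.
binomialSum-suc : ∀ s N h →
  binomialSum (suc s) (suc N) h ≡ binomialSum s (suc N) h +ℚ binomialSum s N (λ j → h (suc j))
binomialSum-suc s N h = begin
  binomialSum (suc s) (suc N) h
    ≡⟨ sumTo-head N _ ⟩
  1ℚ *ℚ h 0 +ℚ sumTo N (λ j → bin (suc s) (suc j) *ℚ h (suc j))
    ≡⟨ cong (1ℚ *ℚ h 0 +ℚ_) (sumTo-cong N (λ j _ →
         trans (cong (_*ℚ h (suc j)) (bin-pascal s j)) (*-distribʳ-+ (h (suc j)) (bin s (suc j)) (bin s j)))) ⟩
  1ℚ *ℚ h 0 +ℚ sumTo N (λ j → bin s (suc j) *ℚ h (suc j) +ℚ bin s j *ℚ h (suc j))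
    ≡⟨ cong (1ℚ *ℚ h 0 +ℚ_) (sumTo-+ N _ _) ⟩
  1ℚ *ℚ h 0 +ℚ (sumTo N (λ j → bin s (suc j) *ℚ h (suc j)) +ℚ binomialSum s N (λ j → h (suc j)))
    ≡⟨ +-assoc (1ℚ *ℚ h 0) _ _ ⟨
  1ℚ *ℚ h 0 +ℚ sumTo N (λ j → bin s (suc j) *ℚ h (suc j)) +ℚ binomialSum s N (λ j → h (suc j))
    ≡⟨ cong (_+ℚ binomialSum s N (λ j → h (suc j))) (sumTo-head N _) ⟨
  binomialSum s (suc N) h +ℚ binomialSum s N (λ j → h (suc j)) ∎

binomialSum-cong : ∀ s N {g h} → g ≗ h → binomialSum s N g ≡ binomialSum s N h
binomialSum-cong s N g≗h = sumTo-cong N (λ j _ → cong (bin s j *ℚ_) (g≗h j))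

-- Binomial theorem for (1 + x (1 + y))ˢ: i counts the chosen factors x (1 + y), so it uses up i
-- powers of x, raises m by i and cannot exceed k.
U-sum : ∀ e m s t k →
  U e m s t k ≡ binomialSum s k (λ i → geo e (k ∸ i) *ℚ bin (m + i) t)
U-sum e m zero t k =
  sym (trans (binomialSum₀ k _) (cong (λ n → geo e k *ℚ bin n t) (ℕ.+-identityʳ m)))
U-sum e m (suc s) t zero = trans (+-identityʳ _) (U-sum e m s t zero)
U-sum e m (suc s) t (suc k) = begin
  U e m s t (suc k) +ℚ U e (suc m) s t k
    ≡⟨ cong₂ _+ℚ_ (U-sum e m s t (suc k)) (U-sum e (suc m) s t k) ⟩
  binomialSum s (suc k) h +ℚ binomialSum s k (λ i → geo e (k ∸ i) *ℚ bin (suc m + i) t)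
    ≡⟨ cong (binomialSum s (suc k) h +ℚ_) (binomialSum-cong s k (λ i →
         cong (λ n → geo e (k ∸ i) *ℚ bin n t) (ℕ.+-suc m i))) ⟨
  binomialSum s (suc k) h +ℚ binomialSum s k (λ i → h (suc i))
    ≡⟨ binomialSum-suc s k h ⟨
  binomialSum (suc s) (suc k) h ∎
  where
  h = λ i → geo e (suc k ∸ i) *ℚ bin (m + i) t

-- Binomial theorem for (1 - x² (1 + y))ˢ: each chosen factor costs x² and a sign. The remaining
-- power of x comes from (1 - x (1 + y))⁻ᵉ and so also enters the top index. Writing `j * 2` lets
-- `suc j * 2` reduce, so that the reindexing is definitional.
V-sum : ∀ e m s t k → V e m s t k ≡
  binomialSum s ⌊ k /2⌋ (λ j → sgn j *ℚ (geo e (k ∸ j * 2) *ℚ bin (m + j + (k ∸ j * 2)) t))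
V-sum e m zero t k =
  sym (trans (binomialSum₀ ⌊ k /2⌋ _) (trans (*-identityˡ _) (cong (λ n → geo e k *ℚ bin (n + k) t) (ℕ.+-identityʳ m))))
V-sum e m (suc s) t zero = trans (+-identityʳ _) (V-sum e m s t zero)
V-sum e m (suc s) t (suc zero) = trans (+-identityʳ _) (V-sum e m s t (suc zero))
V-sum e m (suc s) t (suc (suc k)) = begin
  V e m s t (suc (suc k)) - V e (suc m) s t k
    ≡⟨ cong₂ _-_ (V-sum e m s t (suc (suc k))) (V-sum e (suc m) s t k) ⟩
  S - binomialSum s ⌊ k /2⌋ (λ j → sgn j *ℚ g j)
    ≡⟨ cong (S +ℚ_) (trans (sym (neg-one (binomialSum s ⌊ k /2⌋ (λ j → sgn j *ℚ g j)))) (*-sumTo ⌊ k /2⌋ (- 1ℚ) _)) ⟩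
  S +ℚ sumTo ⌊ k /2⌋ (λ j → - 1ℚ *ℚ (bin s j *ℚ (sgn j *ℚ g j)))
    ≡⟨ cong (S +ℚ_) (sumTo-cong ⌊ k /2⌋ λ j _ → term j) ⟩
  S +ℚ binomialSum s ⌊ k /2⌋ (λ j → h (suc j))
    ≡⟨ binomialSum-suc s ⌊ k /2⌋ h ⟨
  binomialSum (suc s) (suc ⌊ k /2⌋) h ∎
  where
  h = λ j → sgn j *ℚ (geo e (suc (suc k) ∸ j * 2) *ℚ bin (m + j + (suc (suc k) ∸ j * 2)) t)
  g = λ j → geo e (k ∸ j * 2) *ℚ bin (suc m + j + (k ∸ j * 2)) t
  S = binomialSum s (suc ⌊ k /2⌋) h
  neg-one : ∀ a → - 1ℚ *ℚ a ≡ - a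
  neg-one = solve-∀ ℚ-ring
  rearrange : ∀ a b d → - 1ℚ *ℚ (a *ℚ (b *ℚ d)) ≡ a *ℚ (- b *ℚ d)
  rearrange = solve-∀ ℚ-ring
  term : ∀ j → - 1ℚ *ℚ (bin s j *ℚ (sgn j *ℚ g j)) ≡ bin s j *ℚ h (suc j)
  term j = begin
    - 1ℚ *ℚ (bin s j *ℚ (sgn j *ℚ g j)) ≡⟨ rearrange (bin s j) (sgn j) (g j) ⟩
    bin s j *ℚ (- sgn j *ℚ g j) ≡⟨ cong (λ z → bin s j *ℚ (z *ℚ g j)) (sgn-suc j) ⟨
    bin s j *ℚ (sgn (suc j) *ℚ g j)
      ≡⟨ cong (λ n → bin s j *ℚ (sgn (suc j) *ℚ (geo e (k ∸ j * 2) *ℚ bin (n + (k ∸ j * 2)) t))) (ℕ.+-suc m j) ⟨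
    bin s j *ℚ h (suc j) ∎

-- Clearing denominators and factorials.

*-cancelʳ-≡ : ∀ {p q} r → r ≢ 0ℚ → p *ℚ r ≡ q *ℚ r → p ≡ q
*-cancelʳ-≡ {p} {q} r r≢0 pr≡qr = begin
  p ≡⟨ undo p ⟨
  p *ℚ r *ℚ ℚ.1/ r ≡⟨ cong (_*ℚ ℚ.1/ r) pr≡qr ⟩
  q *ℚ r *ℚ ℚ.1/ r ≡⟨ undo q ⟩
  q ∎
  where
  instance _ = ≢-nonZero r≢0
  undo : ∀ p → p *ℚ r *ℚ ℚ.1/ r ≡ p
  undo p = trans (*-assoc p r (ℚ.1/ r)) (trans (cong (p *ℚ_) (*-inverseʳ r)) (*-identityʳ p))

*-≢0 : ∀ {p q} → p ≢ 0ℚ → q ≢ 0ℚ → p *ℚ q ≢ 0ℚ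
*-≢0 {p} {q} p≢0 q≢0 pq≡0 = p≢0 (*-cancelʳ-≡ q q≢0 (trans pq≡0 (sym (*-zeroˡ q))))

÷'-* : ∀ p {q} → q ≢ 0ℚ → (p ÷' q) *ℚ q ≡ p
÷'-* p {q} q≢0 with q ≟ 0ℚ
... | yes q≡0 = contradiction q≡0 q≢0
... | no q≢0′ = trans (*-assoc p _ q) (trans (cong (p *ℚ_) (*-inverseˡ q {{≢-nonZero q≢0′}})) (*-identityʳ p))

ℕ→ℚ-suc≢0 : ∀ n → ℕ→ℚ (suc n) ≢ 0ℚ
ℕ→ℚ-suc≢0 n eq = <⇒≢ (positive⁻¹ (ℕ→ℚ (suc n)) {{normalize-pos (suc n) 1}}) (sym eq)

fac : ℕ → ℚ
fac n = ℕ→ℚ (n !)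

fac-suc : ∀ n → fac (suc n) ≡ ℕ→ℚ (suc n) *ℚ fac n
fac-suc n = ℕ→ℚ-* (suc n) (n !)

fac≢0 : ∀ n → fac n ≢ 0ℚ
fac≢0 zero = λ ()
fac≢0 (suc n) eq = *-≢0 (ℕ→ℚ-suc≢0 n) (fac≢0 n) (trans (sym (fac-suc n)) eq)

bin-fac : ∀ a b → bin (a + b) a *ℚ (fac a *ℚ fac b) ≡ fac (a + b)
bin-fac a b = begin
  bin (a + b) a *ℚ (fac a *ℚ fac b) ≡⟨ cong (bin (a + b) a *ℚ_) (ℕ→ℚ-* (a !) (b !)) ⟨
  bin (a + b) a *ℚ ℕ→ℚ (a ! * b !) ≡⟨ ℕ→ℚ-* ((a + b) C a) (a ! * b !) ⟨
  ℕ→ℚ (((a + b) C a) * (a ! * b !)) ≡⟨ cong (λ d → ℕ→ℚ (((a + b) C a) * (a ! * d !))) (ℕ.m+n∸m≡n a b) ⟨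
  ℕ→ℚ (((a + b) C a) * (a ! * (a + b ∸ a) !))
    ≡⟨ cong (λ d → ℕ→ℚ (d * (a ! * (a + b ∸ a) !))) (nCk≡n!/k![n-k]! a≤a+b) ⟩
  ℕ→ℚ (((a + b) ! ℕ./ (a ! * (a + b ∸ a) !)) * (a ! * (a + b ∸ a) !))
    ≡⟨ cong ℕ→ℚ (m/n*n≡m (k![n∸k]!∣n! a≤a+b)) ⟩
  fac (a + b) ∎
  where
  a≤a+b = ℕ.m≤m+n a b
  instance _ = a ℕ.!* (a + b ∸ a) !≢0

bin≢0 : ∀ a b → bin (a + b) a ≢ 0ℚ
bin≢0 a b eq = fac≢0 (a + b) (begin
  fac (a + b) ≡⟨ bin-fac a b ⟨
  bin (a + b) a *ℚ (fac a *ℚ fac b) ≡⟨ cong (_*ℚ (fac a *ℚ fac b)) eq ⟩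
  0ℚ *ℚ (fac a *ℚ fac b) ≡⟨ *-zeroˡ (fac a *ℚ fac b) ⟩
  0ℚ ∎)

-- For k ≤ n both sides times k! (n - k)! equal (n + 1)!; for k > n both vanish.
bin-absorb : ∀ n k → ℕ→ℚ (suc k) *ℚ bin (suc n) (suc k) ≡ ℕ→ℚ (suc n) *ℚ bin n k
bin-absorb n k with k ℕ.≤? n
... | no k≰n = trans (cong (ℕ→ℚ (suc k) *ℚ_) (bin-vanish (ℕ.s≤s (ℕ.≰⇒> k≰n))))
                 (trans (*-zeroʳ (ℕ→ℚ (suc k)))
                   (sym (trans (cong (ℕ→ℚ (suc n) *ℚ_) (bin-vanish (ℕ.≰⇒> k≰n))) (*-zeroʳ (ℕ→ℚ (suc n))))))
... | yes k≤n with ℕ.m≤n⇒∃[o]m+o≡n k≤n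
... | t , refl = *-cancelʳ-≡ (fac k *ℚ fac t) (*-≢0 (fac≢0 k) (fac≢0 t)) (begin
  ℕ→ℚ (suc k) *ℚ C′ *ℚ (fac k *ℚ fac t) ≡⟨ shuffle (ℕ→ℚ (suc k)) C′ (fac k) (fac t) ⟩
  C′ *ℚ (ℕ→ℚ (suc k) *ℚ fac k *ℚ fac t) ≡⟨ cong (λ z → C′ *ℚ (z *ℚ fac t)) (fac-suc k) ⟨
  C′ *ℚ (fac (suc k) *ℚ fac t) ≡⟨ bin-fac (suc k) t ⟩
  fac (suc (k + t)) ≡⟨ fac-suc (k + t) ⟩
  ℕ→ℚ (suc (k + t)) *ℚ fac (k + t) ≡⟨ cong (ℕ→ℚ (suc (k + t)) *ℚ_) (bin-fac k t) ⟨
  ℕ→ℚ (suc (k + t)) *ℚ (bin (k + t) k *ℚ (fac k *ℚ fac t)) ≡⟨ *-assoc (ℕ→ℚ (suc (k + t))) _ _ ⟨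
  ℕ→ℚ (suc (k + t)) *ℚ bin (k + t) k *ℚ (fac k *ℚ fac t) ∎)
  where
  C′ = bin (suc (k + t)) (suc k)
  shuffle : ∀ s x k t → s *ℚ x *ℚ (k *ℚ t) ≡ x *ℚ (s *ℚ k *ℚ t)
  shuffle = solve-∀ ℚ-ring

-- Times i! k′! s′!, both sides become k! (m + k′)! s! x with k = i + k′. Here q stands for k + m -
-- s, and x for the factor shared by the two summands.
factorial-identity-A : ∀ {i k′ m q s′ s} → i + s′ ≡ s → m + k′ ≡ q + s′ → ∀ x →
  (fac s *ℚ fac q) *ℚ ((bin (i + k′) i *ℚ x) *ℚ bin (m + k′) q)
    ≡ (fac (i + k′) *ℚ fac m) *ℚ (bin s i *ℚ (bin (m + k′) m *ℚ x))
factorial-identity-A {i} {k′} {m} {q} {s′} refl eq x =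
  *-cancelʳ-≡ (fac i *ℚ fac k′ *ℚ fac s′) (*-≢0 (*-≢0 (fac≢0 i) (fac≢0 k′)) (fac≢0 s′)) (begin
  (fac (i + s′) *ℚ fac q) *ℚ ((bin (i + k′) i *ℚ x) *ℚ bin (m + k′) q) *ℚ (fac i *ℚ fac k′ *ℚ fac s′)
    ≡⟨ collectˡ (fac (i + s′)) (fac q) (bin (i + k′) i) x (bin (m + k′) q) (fac i) (fac k′) (fac s′) ⟩
  (bin (i + k′) i *ℚ (fac i *ℚ fac k′)) *ℚ (bin (m + k′) q *ℚ (fac q *ℚ fac s′)) *ℚ (fac (i + s′) *ℚ x)
    ≡⟨ cong₂ (λ y z → y *ℚ z *ℚ (fac (i + s′) *ℚ x)) (bin-fac i k′) middle ⟩
  fac (i + k′) *ℚ fac (m + k′) *ℚ (fac (i + s′) *ℚ x)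
    ≡⟨ cong₂ (λ y z → fac (i + k′) *ℚ y *ℚ (z *ℚ x)) (bin-fac m k′) (bin-fac i s′) ⟨
  fac (i + k′) *ℚ (bin (m + k′) m *ℚ (fac m *ℚ fac k′)) *ℚ ((bin (i + s′) i *ℚ (fac i *ℚ fac s′)) *ℚ x)
    ≡⟨ collectʳ (fac (i + k′)) (fac m) (bin (i + s′) i) x (bin (m + k′) m) (fac i) (fac k′) (fac s′) ⟩
  (fac (i + k′) *ℚ fac m) *ℚ (bin (i + s′) i *ℚ (bin (m + k′) m *ℚ x)) *ℚ (fac i *ℚ fac k′ *ℚ fac s′) ∎)
  where
  middle : bin (m + k′) q *ℚ (fac q *ℚ fac s′) ≡ fac (m + k′)
  middle = subst (λ n → bin n q *ℚ (fac q *ℚ fac s′) ≡ fac n) (sym eq) (bin-fac q s′)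
  collectˡ : ∀ S q β x D i k s → (S *ℚ q) *ℚ ((β *ℚ x) *ℚ D) *ℚ (i *ℚ k *ℚ s)
    ≡ (β *ℚ (i *ℚ k)) *ℚ (D *ℚ (q *ℚ s)) *ℚ (S *ℚ x)
  collectˡ = solve-∀ ℚ-ring
  collectʳ : ∀ K m β x D i k s → K *ℚ (D *ℚ (m *ℚ k)) *ℚ ((β *ℚ (i *ℚ s)) *ℚ x)
    ≡ (K *ℚ m) *ℚ (β *ℚ (D *ℚ x)) *ℚ (i *ℚ k *ℚ s)
  collectʳ = solve-∀ ℚ-ring

-- Beyond cancelling factorials this needs absorption, M C(M - 1, s) = (s + 1) C(M, s + 1), which
-- creates the factor s + 1; the factor p + 1 on the left turns p! into (p + 1)!.
factorial-identity-B : ∀ {j k′ p q s′ s} → let M = suc (j + (p + k′)) in j + s′ ≡ s → M ≡ s′ + q → ∀ σ →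
  ℕ→ℚ (suc p) *ℚ ((fac s *ℚ fac q) *ℚ
    (σ *ℚ ((bin (j + (j + k′)) j *ℚ bin (j + k′) j *ℚ bin (j + (p + k′)) s *ℚ bin M s′)
            ÷' bin (j + (p + k′)) j)))
    ≡ (fac (j + (j + k′)) *ℚ fac (suc p)) *ℚ ℕ→ℚ (suc s)
        *ℚ (bin s j *ℚ (σ *ℚ (bin (p + k′) p *ℚ bin M (suc s))))
factorial-identity-B {j} {k′} {p} {q} {s′} refl eq σ =
  -- `D` clears the division, and `X` supplies the factorials that complete `C₁`, `C₂`, `F` on the
  -- left and `C₃`, `C₄` on the right; `E` and `G` are left to absorption.
  *-cancelʳ-≡ (D *ℚ X) (*-≢0 (bin≢0 j (p + k′))
    (*-≢0 (*-≢0 (*-≢0 (*-≢0 (fac≢0 j) (fac≢0 j)) (fac≢0 k′)) (fac≢0 s′)) (fac≢0 (j + k′)))) (begin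
  μ *ℚ ((S *ℚ fq) *ℚ (σ *ℚ (N ÷' D))) *ℚ (D *ℚ X)
    ≡⟨ pull μ S fq σ (N ÷' D) D X ⟩
  μ *ℚ (S *ℚ fq) *ℚ σ *ℚ (N ÷' D *ℚ D) *ℚ X
    ≡⟨ cong (λ z → μ *ℚ (S *ℚ fq) *ℚ σ *ℚ z *ℚ X) (÷'-* N (bin≢0 j (p + k′))) ⟩
  μ *ℚ (S *ℚ fq) *ℚ σ *ℚ N *ℚ X
    ≡⟨ collectˡ μ S fq σ C₁ C₂ E F fj fk fs J ⟩
  μ *ℚ S *ℚ σ *ℚ E *ℚ ((C₁ *ℚ (fj *ℚ J)) *ℚ (C₂ *ℚ (fj *ℚ fk)) *ℚ (F *ℚ (fs *ℚ fq)))
    ≡⟨ cong (λ z → μ *ℚ S *ℚ σ *ℚ E *ℚ z) (cong₂ _*ℚ_ (cong₂ _*ℚ_ (bin-fac j (j + k′)) (bin-fac j k′)) F-fac) ⟩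
  μ *ℚ S *ℚ σ *ℚ E *ℚ (K *ℚ J *ℚ fac M)
    ≡⟨ cong (λ z → μ *ℚ S *ℚ σ *ℚ E *ℚ (K *ℚ J *ℚ z)) (fac-suc (j + (p + k′))) ⟩
  μ *ℚ S *ℚ σ *ℚ E *ℚ (K *ℚ J *ℚ (ℕ→ℚ M *ℚ fac (j + (p + k′))))
    ≡⟨ cong (λ z → μ *ℚ S *ℚ σ *ℚ E *ℚ (K *ℚ J *ℚ (ℕ→ℚ M *ℚ z))) (bin-fac j (p + k′)) ⟨
  μ *ℚ S *ℚ σ *ℚ E *ℚ (K *ℚ J *ℚ (ℕ→ℚ M *ℚ (D *ℚ (fj *ℚ P))))
    ≡⟨ swap μ S σ E K J (ℕ→ℚ M) D (fj) P ⟩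
  K *ℚ μ *ℚ σ *ℚ J *ℚ (ℕ→ℚ M *ℚ E) *ℚ P *ℚ S *ℚ (D *ℚ fj)
    ≡⟨ cong (λ z → K *ℚ μ *ℚ σ *ℚ J *ℚ z *ℚ P *ℚ S *ℚ (D *ℚ fj)) (bin-absorb (j + (p + k′)) s) ⟨
  K *ℚ μ *ℚ σ *ℚ J *ℚ (ℕ→ℚ (suc s) *ℚ G) *ℚ P *ℚ S *ℚ (D *ℚ fj)
    ≡⟨ cong₂ (λ y z → K *ℚ μ *ℚ σ *ℚ J *ℚ (ℕ→ℚ (suc s) *ℚ G) *ℚ y *ℚ z *ℚ (D *ℚ fj)) (bin-fac p k′) (bin-fac j s′) ⟨
  K *ℚ μ *ℚ σ *ℚ J *ℚ (ℕ→ℚ (suc s) *ℚ G) *ℚ (C₃ *ℚ (fp *ℚ fk)) *ℚ (C₄ *ℚ (fj *ℚ fs)) *ℚ (D *ℚ fj)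
    ≡⟨ collectʳ K μ σ J (ℕ→ℚ (suc s)) G C₃ fp fk C₄ fj fs D ⟩
  (K *ℚ (μ *ℚ fp)) *ℚ ℕ→ℚ (suc s) *ℚ (C₄ *ℚ (σ *ℚ (C₃ *ℚ G))) *ℚ (D *ℚ X)
    ≡⟨ cong (λ z → (K *ℚ z) *ℚ ℕ→ℚ (suc s) *ℚ (C₄ *ℚ (σ *ℚ (C₃ *ℚ G))) *ℚ (D *ℚ X)) (fac-suc p) ⟨
  (K *ℚ fac (suc p)) *ℚ ℕ→ℚ (suc s) *ℚ (C₄ *ℚ (σ *ℚ (C₃ *ℚ G))) *ℚ (D *ℚ X) ∎)
  where
  M = suc (j + (p + k′))
  s = j + s′
  μ = ℕ→ℚ (suc p)
  S = fac s
  fq = fac q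
  fj = fac j
  fk = fac k′
  fs = fac s′
  fp = fac p
  J = fac (j + k′)
  K = fac (j + (j + k′))
  P = fac (p + k′)
  C₁ = bin (j + (j + k′)) j
  C₂ = bin (j + k′) j
  C₃ = bin (p + k′) p
  C₄ = bin s j
  D = bin (j + (p + k′)) j
  E = bin (j + (p + k′)) s
  F = bin M s′
  G = bin M (suc s)
  N = C₁ *ℚ C₂ *ℚ E *ℚ F
  X = fj *ℚ fj *ℚ fk *ℚ fs *ℚ J
  F-fac : F *ℚ (fs *ℚ fq) ≡ fac M
  F-fac = subst (λ n → bin n s′ *ℚ (fs *ℚ fq) ≡ fac n) (sym eq) (bin-fac s′ q)
  pull : ∀ μ S q σ y D X → μ *ℚ ((S *ℚ q) *ℚ (σ *ℚ y)) *ℚ (D *ℚ X) ≡ μ *ℚ (S *ℚ q) *ℚ σ *ℚ (y *ℚ D) *ℚ X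
  pull = solve-∀ ℚ-ring
  collectˡ : ∀ μ S q σ C₁ C₂ E F j k s J →
    μ *ℚ (S *ℚ q) *ℚ σ *ℚ (C₁ *ℚ C₂ *ℚ E *ℚ F) *ℚ (j *ℚ j *ℚ k *ℚ s *ℚ J)
      ≡ μ *ℚ S *ℚ σ *ℚ E *ℚ ((C₁ *ℚ (j *ℚ J)) *ℚ (C₂ *ℚ (j *ℚ k)) *ℚ (F *ℚ (s *ℚ q)))
  collectˡ = solve-∀ ℚ-ring
  swap : ∀ μ S σ E K J M D j P →
    μ *ℚ S *ℚ σ *ℚ E *ℚ (K *ℚ J *ℚ (M *ℚ (D *ℚ (j *ℚ P)))) ≡ K *ℚ μ *ℚ σ *ℚ J *ℚ (M *ℚ E) *ℚ P *ℚ S *ℚ (D *ℚ j)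
  swap = solve-∀ ℚ-ring
  collectʳ : ∀ K μ σ J s₁ G C₃ p k C₄ j s D →
    K *ℚ μ *ℚ σ *ℚ J *ℚ (s₁ *ℚ G) *ℚ (C₃ *ℚ (p *ℚ k)) *ℚ (C₄ *ℚ (j *ℚ s)) *ℚ (D *ℚ j)
      ≡ (K *ℚ (μ *ℚ p)) *ℚ s₁ *ℚ (C₄ *ℚ (σ *ℚ (C₃ *ℚ G))) *ℚ (D *ℚ (j *ℚ j *ℚ k *ℚ s *ℚ J))
  collectʳ = solve-∀ ℚ-ring

-- Comparison of single summands, degenerate cases included.

0÷' : ∀ p {q} → q ≢ 0ℚ → (p *ℚ 0ℚ) ÷' q ≡ 0ℚ
0÷' p {q} q≢0 = *-cancelʳ-≡ q q≢0 (trans (÷'-* (p *ℚ 0ℚ) q≢0) (trans (*-zeroʳ p) (sym (*-zeroˡ q))))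

binom-⊖-≤ : ∀ a {b d} → d ≤ b → binom a (b ℤ.⊖ d) ≡ bin a (b ∸ d)
binom-⊖-≤ a d≤b = cong (binom a) (ℤ.⊖-≥ d≤b)

binom-⊖-< : ∀ a {b d} → b < d → binom a (b ℤ.⊖ d) ≡ 0ℚ
binom-⊖-< a {b} b<d with ℕ.m≤n⇒∃[o]m+o≡n b<d
... | o , refl = cong (binom a) (trans (ℤ.⊖-< b<d) (cong (λ n → ℤ.- (ℤ.+ n)) eq))
  where
  eq : suc b + o ∸ b ≡ suc o
  eq = trans (cong (ℕ._∸ b) (sym (ℕ.+-suc b o))) (ℕ.m+n∸m≡n b (suc o))

⊖-suc-minus : ∀ s j → (ℤ.+ suc s) ℤ.- (ℤ.+ j) ℤ.- (ℤ.+ 1) ≡ s ℤ.⊖ j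
⊖-suc-minus s j = trans (cancel-one (ℤ.+ s) (ℤ.+ j)) (ℤ.m-n≡m⊖n s j)
  where
  cancel-one : ∀ x y → (ℤ.+ 1 ℤ.+ x) ℤ.- y ℤ.- (ℤ.+ 1) ≡ x ℤ.- y
  cancel-one = ℤ-Solver.solve-∀

module _ (i k′ p s : ℕ) where
  private
    k m M q : ℕ
    k = i + k′
    m = suc p
    M = k + m
    q = M ∸ s
    σ a x : ℚ
    σ = fac s *ℚ fac q
    a = fac k *ℚ fac m
    x = bin (m + i) (suc s)

    M≡i+ : ∀ i k′ m → i + k′ + m ≡ i + (m + k′)
    M≡i+ = ℕ-Solver.solve-∀

    top-too-small : m + i ≤ s →
      σ *ℚ (bin k i *ℚ x *ℚ binom (m + k′) (M ℤ.⊖ s)) ≡ a *ℚ (bin s i *ℚ (geo (suc m) k′ *ℚ x))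
    top-too-small m+i≤s = begin
      σ *ℚ (bin k i *ℚ x *ℚ b)
        ≡⟨ cong (λ z → σ *ℚ (bin k i *ℚ z *ℚ b)) x≡0 ⟩
      σ *ℚ (bin k i *ℚ 0ℚ *ℚ b)
        ≡⟨ vanish σ (bin k i) b a (bin s i) (geo (suc m) k′) ⟩
      a *ℚ (bin s i *ℚ (geo (suc m) k′ *ℚ 0ℚ))
        ≡⟨ cong (λ z → a *ℚ (bin s i *ℚ (geo (suc m) k′ *ℚ z))) x≡0 ⟨
      a *ℚ (bin s i *ℚ (geo (suc m) k′ *ℚ x)) ∎
      where
      b = binom (m + k′) (M ℤ.⊖ s)
      x≡0 : x ≡ 0ℚ
      x≡0 = bin-vanish (ℕ.s≤s m+i≤s)
      vanish : ∀ σ β b a d e → σ *ℚ (β *ℚ 0ℚ *ℚ b) ≡ a *ℚ (d *ℚ (e *ℚ 0ℚ))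
      vanish = solve-∀ ℚ-ring

    regular : ∀ s′ → i + s′ ≡ s → s ≤ M →
      σ *ℚ (bin k i *ℚ x *ℚ bin (m + k′) q) ≡ a *ℚ (bin s i *ℚ (bin (m + k′) m *ℚ x))
    regular s′ eq s≤M = factorial-identity-A {i} {k′} {m} {q} {s′} eq split x
      where
      reorder : ∀ q i s′ → q + (i + s′) ≡ i + (q + s′)
      reorder = ℕ-Solver.solve-∀
      split : m + k′ ≡ q + s′
      split = ℕ.+-cancelˡ-≡ i _ _ (trans (sym (M≡i+ i k′ m))
        (trans (sym (ℕ.m∸n+n≡m s≤M)) (trans (cong (q ℕ.+_) (sym eq)) (reorder q i s′))))

    index-too-big : s < i → s ≤ M →
      σ *ℚ (bin k i *ℚ x *ℚ bin (m + k′) q) ≡ a *ℚ (bin s i *ℚ (bin (m + k′) m *ℚ x))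
    index-too-big s<i s≤M = begin
      σ *ℚ (bin k i *ℚ x *ℚ bin (m + k′) q)
        ≡⟨ cong (λ z → σ *ℚ (bin k i *ℚ x *ℚ z)) (bin-vanish small) ⟩
      σ *ℚ (bin k i *ℚ x *ℚ 0ℚ)
        ≡⟨ vanish σ (bin k i) x a (bin (m + k′) m) ⟩
      a *ℚ (0ℚ *ℚ (bin (m + k′) m *ℚ x))
        ≡⟨ cong (λ z → a *ℚ (z *ℚ (bin (m + k′) m *ℚ x))) (bin-vanish s<i) ⟨
      a *ℚ (bin s i *ℚ (bin (m + k′) m *ℚ x)) ∎
      where
      small : m + k′ < q
      -- Since s + q = M = i + (m + k′), s < i forces m + k′ < q.
      small = ℕ.+-cancelˡ-< s _ _ (ℕ.<-≤-trans (ℕ.+-monoˡ-< (m + k′) s<i)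
        (ℕ.≤-reflexive (trans (sym (M≡i+ i k′ m)) (sym (ℕ.m+[n∸m]≡n s≤M)))))
      vanish : ∀ σ β x a e → σ *ℚ (β *ℚ x *ℚ 0ℚ) ≡ a *ℚ (0ℚ *ℚ (e *ℚ x))
      vanish = solve-∀ ℚ-ring

    top-large : s < m + i →
      σ *ℚ (bin k i *ℚ x *ℚ binom (m + k′) (M ℤ.⊖ s)) ≡ a *ℚ (bin s i *ℚ (geo (suc m) k′ *ℚ x))
    top-large s<m+i = begin
      σ *ℚ (bin k i *ℚ x *ℚ binom (m + k′) (M ℤ.⊖ s))
        ≡⟨ cong (λ z → σ *ℚ (bin k i *ℚ x *ℚ z)) (binom-⊖-≤ (m + k′) s≤M) ⟩
      σ *ℚ (bin k i *ℚ x *ℚ bin (m + k′) q)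
        ≡⟨ [ (λ i≤s → regular (s ∸ i) (ℕ.m+[n∸m]≡n i≤s) s≤M) , (λ s<i → index-too-big s<i s≤M) ]′ (ℕ.≤-<-connex i s) ⟩
      a *ℚ (bin s i *ℚ (bin (m + k′) m *ℚ x))
        ≡⟨ cong (λ z → a *ℚ (bin s i *ℚ (z *ℚ x))) (geo-C m k′) ⟨
      a *ℚ (bin s i *ℚ (geo (suc m) k′ *ℚ x)) ∎
      where
      s≤M : s ≤ M
      s≤M = ℕ.≤-trans (ℕ.<⇒≤ s<m+i) (ℕ.≤-trans (ℕ.≤-reflexive (ℕ.+-comm m i)) (ℕ.+-monoˡ-≤ m (ℕ.m≤m+n i k′)))

  -- If m + i ≤ s, the factor with lower index s + 1 makes both sides zero; this covers every s > k
  -- + m, where `∸` truncates and the lower index of `binom` is negative. Otherwise the subtraction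
  -- is exact: the factorial identity handles i ≤ s, and both sides vanish for i > s.
  summand-A : (fac s *ℚ fac (i + k′ + suc p ∸ s)) *ℚ
      (bin (i + k′) i *ℚ bin (suc p + i) (suc s) *ℚ binom (suc p + k′) (i + k′ + suc p ℤ.⊖ s))
    ≡ (fac (i + k′) *ℚ fac (suc p)) *ℚ (bin s i *ℚ (geo (suc (suc p)) k′ *ℚ bin (suc p + i) (suc s)))
  summand-A = [ top-too-small , top-large ]′ (ℕ.≤-<-connex (m + i) s)

module _ (j k′ p s : ℕ) where
  private
    k m N : ℕ
    k = j + (j + k′)
    m = suc p
    N = j + (p + k′)
    μ σ a β x b d : ℚ
    μ = ℕ→ℚ m
    σ = fac s *ℚ fac (k + m ∸ s)
    a = (fac k *ℚ fac m) *ℚ ℕ→ℚ (suc s)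
    β = bin k j *ℚ bin (j + k′) j
    x = bin (suc N) (suc s)
    b = binom (suc N) (s ℤ.⊖ j)
    d = bin N j

    Summand : Set
    Summand = μ *ℚ (σ *ℚ (sgn j *ℚ ((β *ℚ bin N s *ℚ b) ÷' d))) ≡ a *ℚ (bin s j *ℚ (sgn j *ℚ (geo m k′ *ℚ x)))

    index-too-big : s < j → Summand
    index-too-big s<j = begin
      μ *ℚ (σ *ℚ (sgn j *ℚ ((β *ℚ bin N s *ℚ b) ÷' d)))
        ≡⟨ cong (λ z → μ *ℚ (σ *ℚ (sgn j *ℚ ((β *ℚ bin N s *ℚ z) ÷' d)))) (binom-⊖-< (suc N) s<j) ⟩
      μ *ℚ (σ *ℚ (sgn j *ℚ ((β *ℚ bin N s *ℚ 0ℚ) ÷' d)))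
        ≡⟨ cong (λ z → μ *ℚ (σ *ℚ (sgn j *ℚ z))) (0÷' (β *ℚ bin N s) (bin≢0 j (p + k′))) ⟩
      μ *ℚ (σ *ℚ (sgn j *ℚ 0ℚ))
        ≡⟨ vanish μ σ (sgn j) a (geo m k′ *ℚ x) ⟩
      a *ℚ (0ℚ *ℚ (sgn j *ℚ (geo m k′ *ℚ x)))
        ≡⟨ cong (λ z → a *ℚ (z *ℚ (sgn j *ℚ (geo m k′ *ℚ x)))) (bin-vanish s<j) ⟨
      a *ℚ (bin s j *ℚ (sgn j *ℚ (geo m k′ *ℚ x))) ∎
      where
      vanish : ∀ μ σ e a f → μ *ℚ (σ *ℚ (e *ℚ 0ℚ)) ≡ a *ℚ (0ℚ *ℚ (e *ℚ f))
      vanish = solve-∀ ℚ-ring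

    top-too-small : N < s → Summand
    top-too-small N<s = begin
      μ *ℚ (σ *ℚ (sgn j *ℚ ((β *ℚ bin N s *ℚ b) ÷' d)))
        ≡⟨ cong (λ z → μ *ℚ (σ *ℚ (sgn j *ℚ ((β *ℚ z *ℚ b) ÷' d)))) (bin-vanish N<s) ⟩
      μ *ℚ (σ *ℚ (sgn j *ℚ ((β *ℚ 0ℚ *ℚ b) ÷' d)))
        ≡⟨ cong (λ z → μ *ℚ (σ *ℚ (sgn j *ℚ (z ÷' d)))) (swap β b) ⟩
      μ *ℚ (σ *ℚ (sgn j *ℚ ((β *ℚ b *ℚ 0ℚ) ÷' d)))
        ≡⟨ cong (λ z → μ *ℚ (σ *ℚ (sgn j *ℚ z))) (0÷' (β *ℚ b) (bin≢0 j (p + k′))) ⟩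
      μ *ℚ (σ *ℚ (sgn j *ℚ 0ℚ))
        ≡⟨ vanish μ σ (sgn j) a (bin s j) (geo m k′) ⟩
      a *ℚ (bin s j *ℚ (sgn j *ℚ (geo m k′ *ℚ 0ℚ)))
        ≡⟨ cong (λ z → a *ℚ (bin s j *ℚ (sgn j *ℚ (geo m k′ *ℚ z)))) (bin-vanish (ℕ.s≤s N<s)) ⟨
      a *ℚ (bin s j *ℚ (sgn j *ℚ (geo m k′ *ℚ x))) ∎
      where
      swap : ∀ β b → β *ℚ 0ℚ *ℚ b ≡ β *ℚ b *ℚ 0ℚ
      swap = solve-∀ ℚ-ring
      vanish : ∀ μ σ e a f g → μ *ℚ (σ *ℚ (e *ℚ 0ℚ)) ≡ a *ℚ (f *ℚ (e *ℚ (g *ℚ 0ℚ)))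
      vanish = solve-∀ ℚ-ring

    regular : j ≤ s → s ≤ N → Summand
    regular j≤s s≤N = begin
      μ *ℚ (σ *ℚ (sgn j *ℚ ((β *ℚ bin N s *ℚ b) ÷' d)))
        ≡⟨ cong (λ z → μ *ℚ (σ *ℚ (sgn j *ℚ ((β *ℚ bin N s *ℚ z) ÷' d)))) (binom-⊖-≤ (suc N) j≤s) ⟩
      μ *ℚ (σ *ℚ (sgn j *ℚ ((β *ℚ bin N s *ℚ bin (suc N) (s ∸ j)) ÷' d)))
        ≡⟨ factorial-identity-B {j} {k′} {p} {k + m ∸ s} {s ∸ j} (ℕ.m+[n∸m]≡n j≤s) split (sgn j) ⟩
      a *ℚ (bin s j *ℚ (sgn j *ℚ (bin (p + k′) p *ℚ x)))
        ≡⟨ cong (λ z → a *ℚ (bin s j *ℚ (sgn j *ℚ (z *ℚ x)))) (geo-C p k′) ⟨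
      a *ℚ (bin s j *ℚ (sgn j *ℚ (geo m k′ *ℚ x))) ∎
      where
      M≡ : ∀ j k′ p → j + suc (j + (p + k′)) ≡ j + (j + k′) + suc p
      M≡ = ℕ-Solver.solve-∀
      s≤M : s ≤ k + m
      s≤M = ℕ.≤-trans s≤N (ℕ.≤-trans (ℕ.≤-trans (ℕ.n≤1+n N) (ℕ.m≤n+m (suc N) j)) (ℕ.≤-reflexive (M≡ j k′ p)))
      split : suc N ≡ (s ∸ j) + (k + m ∸ s)
      split = ℕ.+-cancelˡ-≡ j _ _ (begin
        j + suc N ≡⟨ M≡ j k′ p ⟩
        k + m ≡⟨ ℕ.m+[n∸m]≡n s≤M ⟨
        s + (k + m ∸ s) ≡⟨ cong (ℕ._+ (k + m ∸ s)) (ℕ.m+[n∸m]≡n j≤s) ⟨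
        j + (s ∸ j) + (k + m ∸ s) ≡⟨ ℕ.+-assoc j (s ∸ j) _ ⟩
        j + ((s ∸ j) + (k + m ∸ s)) ∎)

  -- For j > s the lower index s - j is negative and `bin s j` is zero. For N < s both `bin N s` and
  -- `bin (suc N) (suc s)` are zero. In between, the factorial identity applies. The denominator is
  -- never zero, as N = j + (p + k′) is at least j.
  summand-B : let k = j + (j + k′); m = suc p; N = j + (p + k′) in
    ℕ→ℚ m *ℚ ((fac s *ℚ fac (k + m ∸ s)) *ℚ
      (sgn j *ℚ ((bin k j *ℚ bin (j + k′) j *ℚ bin N s *ℚ binom (suc N) (s ℤ.⊖ j)) ÷' bin N j)))
    ≡ (fac k *ℚ fac m) *ℚ ℕ→ℚ (suc s) *ℚ (bin s j *ℚ (sgn j *ℚ (geo m k′ *ℚ bin (suc N) (suc s))))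
  summand-B = [ (λ j≤s → [ regular j≤s , top-too-small ]′ (ℕ.≤-<-connex s N)) , index-too-big ]′ (ℕ.≤-<-connex j s)

-- From the sums of the theorem to the coefficients of the series.

sum-A sum-B : (n k r : ℕ) → ℚ
-- The range from 0 to k exhausts the sum over all integers i, as C(k, i) vanishes elsewhere.
sum-A n k r = sumTo k (λ i → binom k (ℤ.+ i) *ℚ binom (n ∸ k + i ∸ 1) (ℤ.+ r)
  *ℚ binom (n ∸ i ∸ 1) (ℤ.+ n ℤ.- ℤ.+ r))
sum-B n k r = sumTo ⌊ k /2⌋ (λ j → sgn j *ℚ
  ((binom k (ℤ.+ j) *ℚ binom (k ∸ j) (ℤ.+ j) *ℚ binom (n ∸ j ∸ 2) (ℤ.+ r ℤ.- ℤ.+ 1)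
    *ℚ binom (n ∸ j ∸ 1) (ℤ.+ r ℤ.- ℤ.+ j ℤ.- ℤ.+ 1))
   ÷' binom (n ∸ j ∸ 2) (ℤ.+ j)))

n≡1+M : ∀ i k′ p → i + k′ + 2 + p ≡ suc (i + k′ + suc p)
n≡1+M = ℕ-Solver.solve-∀

n∸k : ∀ k p → k + 2 + p ∸ k ≡ suc (suc p)
n∸k k p = trans (cong (ℕ._∸ k) (ℕ.+-assoc k 2 p)) (ℕ.m+n∸m≡n k (2 + p))

n∸i : ∀ i k′ p → i + k′ + 2 + p ∸ i ≡ suc (suc p + k′)
n∸i i k′ p = trans (cong (ℕ._∸ i) (reorder i k′ p)) (ℕ.m+n∸m≡n i _)
  where
  reorder : ∀ i k′ p → i + k′ + 2 + p ≡ i + suc (suc p + k′)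
  reorder = ℕ-Solver.solve-∀

k∸2j : ∀ j k′ → j + j + k′ ∸ j * 2 ≡ k′
k∸2j j k′ = trans (cong (ℕ._∸ j * 2) (double j k′)) (ℕ.m+n∸m≡n (j * 2) k′)
  where
  double : ∀ j k′ → j + j + k′ ≡ j * 2 + k′
  double = ℕ-Solver.solve-∀

n∸j : ∀ j k′ p → j + (j + k′) + 2 + p ∸ j ≡ suc (suc (j + (p + k′)))
n∸j j k′ p = trans (cong (ℕ._∸ j) (reorder j k′ p)) (ℕ.m+n∸m≡n j _)
  where
  reorder : ∀ j k′ p → j + (j + k′) + 2 + p ≡ j + suc (suc (j + (p + k′)))
  reorder = ℕ-Solver.solve-∀

p+j+k′ : ∀ j k′ p → p + j + k′ ≡ j + (p + k′)
p+j+k′ = ℕ-Solver.solve-∀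

-- With k replaced by i + k′, the truncated differences become exact; n - r turns into (k + m) - s
-- because n = k + m + 1 and r = s + 1.
statement-summand-A : ∀ k i k′ p s → i + k′ ≡ k → let n = k + 2 + p; m = suc p in
  (fac s *ℚ fac (k + m ∸ s)) *ℚ (binom k (ℤ.+ i) *ℚ binom (n ∸ k + i ∸ 1) (ℤ.+ suc s)
    *ℚ binom (n ∸ i ∸ 1) (ℤ.+ n ℤ.- ℤ.+ suc s))
  ≡ (fac k *ℚ fac m) *ℚ (bin s i *ℚ (geo (suc m) (k ∸ i) *ℚ bin (m + i) (suc s)))
statement-summand-A _ i k′ p s refl = begin
  σ *ℚ (bin k i *ℚ bin (n ∸ k + i ∸ 1) (suc s) *ℚ binom (n ∸ i ∸ 1) (ℤ.+ n ℤ.- ℤ.+ suc s))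
    ≡⟨ cong₂ (λ x y → σ *ℚ (bin k i *ℚ bin x (suc s) *ℚ y))
         (cong (λ d → d + i ∸ 1) (n∸k k p)) (cong₂ binom (cong (ℕ._∸ 1) (n∸i i k′ p)) n-r) ⟩
  σ *ℚ (bin k i *ℚ bin (m + i) (suc s) *ℚ binom (m + k′) (k + m ℤ.⊖ s))
    ≡⟨ summand-A i k′ p s ⟩
  (fac k *ℚ fac m) *ℚ (bin s i *ℚ (geo (suc m) k′ *ℚ bin (m + i) (suc s)))
    ≡⟨ cong (λ l → (fac k *ℚ fac m) *ℚ (bin s i *ℚ (geo (suc m) l *ℚ bin (m + i) (suc s)))) (ℕ.m+n∸m≡n i k′) ⟨
  (fac k *ℚ fac m) *ℚ (bin s i *ℚ (geo (suc m) (k ∸ i) *ℚ bin (m + i) (suc s))) ∎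
  where
  m = suc p
  k = i + k′
  n = k + 2 + p
  σ = fac s *ℚ fac (k + m ∸ s)
  n-r : ℤ.+ n ℤ.- ℤ.+ suc s ≡ k + m ℤ.⊖ s
  n-r = trans (ℤ.m-n≡m⊖n n (suc s))
    (trans (cong (ℤ._⊖ suc s) (n≡1+M i k′ p)) (ℤ.[1+m]⊖[1+n]≡m⊖n (k + m) s))

sum-A-closed : ∀ k p s → let n = k + 2 + p; m = suc p in
  (fac s *ℚ fac (k + m ∸ s)) *ℚ sum-A n k (suc s) ≡ (fac k *ℚ fac m) *ℚ A m s k
sum-A-closed k p s = begin
  σ *ℚ sum-A n k (suc s)
    ≡⟨ *-sumTo k σ _ ⟩
  sumTo k (λ i → σ *ℚ (binom k (ℤ.+ i) *ℚ binom (n ∸ k + i ∸ 1) (ℤ.+ suc s)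
    *ℚ binom (n ∸ i ∸ 1) (ℤ.+ n ℤ.- ℤ.+ suc s)))
    ≡⟨ sumTo-cong k (λ i i≤k → statement-summand-A k i (k ∸ i) p s (ℕ.m+[n∸m]≡n i≤k)) ⟩
  sumTo k (λ i → (fac k *ℚ fac m) *ℚ (bin s i *ℚ (geo (suc m) (k ∸ i) *ℚ bin (m + i) (suc s))))
    ≡⟨ *-sumTo k (fac k *ℚ fac m) _ ⟨
  (fac k *ℚ fac m) *ℚ binomialSum s k (λ i → geo (suc m) (k ∸ i) *ℚ bin (m + i) (suc s))
    ≡⟨ cong ((fac k *ℚ fac m) *ℚ_) (U-sum (suc m) m s (suc s) k) ⟨
  (fac k *ℚ fac m) *ℚ A m s k ∎
  where
  n = k + 2 + p
  m = suc p
  σ = fac s *ℚ fac (k + m ∸ s)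

term-B : (k p s j : ℕ) → ℚ
term-B k p s j = let n = k + 2 + p in sgn j *ℚ
  ((binom k (ℤ.+ j) *ℚ binom (k ∸ j) (ℤ.+ j) *ℚ binom (n ∸ j ∸ 2) (ℤ.+ suc s ℤ.- ℤ.+ 1)
    *ℚ binom (n ∸ j ∸ 1) (ℤ.+ suc s ℤ.- ℤ.+ j ℤ.- ℤ.+ 1))
   ÷' binom (n ∸ j ∸ 2) (ℤ.+ j))

statement-summand-B : ∀ k j k′ p s → j + j + k′ ≡ k → let m = suc p in
  ℕ→ℚ m *ℚ ((fac s *ℚ fac (k + m ∸ s)) *ℚ term-B k p s j)
  ≡ (fac k *ℚ fac m) *ℚ ℕ→ℚ (suc s)
     *ℚ (bin s j *ℚ (sgn j *ℚ (geo m (k ∸ j * 2) *ℚ bin (m + j + (k ∸ j * 2)) (suc s))))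
statement-summand-B _ j k′ p s refl = begin
  μ *ℚ (σ′ (j + j + k′) *ℚ term-B (j + j + k′) p s j)
    ≡⟨ cong (λ k → μ *ℚ (σ′ k *ℚ term-B k p s j)) (ℕ.+-assoc j j k′) ⟩
  μ *ℚ (σ′ k *ℚ (sgn j *ℚ
    ((bin k j *ℚ bin (k ∸ j) j *ℚ bin (n ∸ j ∸ 2) s *ℚ binom (n ∸ j ∸ 1) (ℤ.+ suc s ℤ.- ℤ.+ j ℤ.- ℤ.+ 1))
      ÷' bin (n ∸ j ∸ 2) j)))
    ≡⟨ cong₂ (λ d w → μ *ℚ (σ′ k *ℚ (sgn j *ℚ
         ((bin k j *ℚ bin (k ∸ j) j *ℚ bin (d ∸ 2) s *ℚ binom (d ∸ 1) w) ÷' bin (d ∸ 2) j))))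
         (n∸j j k′ p) (⊖-suc-minus s j) ⟩
  μ *ℚ (σ′ k *ℚ (sgn j *ℚ ((bin k j *ℚ bin (k ∸ j) j *ℚ bin N s *ℚ binom (suc N) (s ℤ.⊖ j)) ÷' bin N j)))
    ≡⟨ cong (λ d → μ *ℚ (σ′ k *ℚ (sgn j *ℚ ((bin k j *ℚ bin d j *ℚ bin N s *ℚ binom (suc N) (s ℤ.⊖ j)) ÷' bin N j))))
         (ℕ.m+n∸m≡n j (j + k′)) ⟩
  μ *ℚ (σ′ k *ℚ (sgn j *ℚ ((bin k j *ℚ bin (j + k′) j *ℚ bin N s *ℚ binom (suc N) (s ℤ.⊖ j)) ÷' bin N j)))
    ≡⟨ summand-B j k′ p s ⟩
  rhs k k′ (suc N)
    ≡⟨ cong (rhs k k′) (cong suc (p+j+k′ j k′ p)) ⟨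
  rhs k k′ (m + j + k′)
    ≡⟨ cong₂ (λ k l → rhs k l (m + j + l)) (ℕ.+-assoc j j k′) (k∸2j j k′) ⟨
  rhs (j + j + k′) (j + j + k′ ∸ j * 2) (m + j + (j + j + k′ ∸ j * 2)) ∎
  where
  m = suc p
  μ = ℕ→ℚ m
  k = j + (j + k′)
  n = k + 2 + p
  N = j + (p + k′)
  σ′ : ℕ → ℚ
  σ′ k = fac s *ℚ fac (k + m ∸ s)
  rhs : ℕ → ℕ → ℕ → ℚ
  rhs k l M = (fac k *ℚ fac m) *ℚ ℕ→ℚ (suc s) *ℚ (bin s j *ℚ (sgn j *ℚ (geo m l *ℚ bin M (suc s))))

-- Compared with `sum-A-closed`, the extra factors are m = n - k - 1 on the left and s + 1 = r on
-- the right. They account for the different prefactors of the two sums.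
sum-B-closed : ∀ k p s → let n = k + 2 + p; m = suc p in
  ℕ→ℚ m *ℚ ((fac s *ℚ fac (k + m ∸ s)) *ℚ sum-B n k (suc s)) ≡ (fac k *ℚ fac m) *ℚ ℕ→ℚ (suc s) *ℚ B m s k
sum-B-closed k p s = begin
  ℕ→ℚ m *ℚ (σ *ℚ sum-B n k (suc s))
    ≡⟨ cong (ℕ→ℚ m *ℚ_) (*-sumTo ⌊ k /2⌋ σ _) ⟩
  ℕ→ℚ m *ℚ sumTo ⌊ k /2⌋ (λ j → σ *ℚ term-B k p s j)
    ≡⟨ *-sumTo ⌊ k /2⌋ (ℕ→ℚ m) _ ⟩
  sumTo ⌊ k /2⌋ (λ j → ℕ→ℚ m *ℚ (σ *ℚ term-B k p s j))
    ≡⟨ sumTo-cong ⌊ k /2⌋ (λ j j≤k/2 → statement-summand-B k j (k ∸ (j + j)) p s (ℕ.m+[n∸m]≡n (j+j≤k j≤k/2))) ⟩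
  sumTo ⌊ k /2⌋ (λ j → a *ℚ (bin s j *ℚ (sgn j *ℚ (geo m (k ∸ j * 2) *ℚ bin (m + j + (k ∸ j * 2)) (suc s)))))
    ≡⟨ *-sumTo ⌊ k /2⌋ a _ ⟨
  a *ℚ binomialSum s ⌊ k /2⌋ (λ j → sgn j *ℚ (geo m (k ∸ j * 2) *ℚ bin (m + j + (k ∸ j * 2)) (suc s)))
    ≡⟨ cong (a *ℚ_) (V-sum m m s (suc s) k) ⟨
  a *ℚ B m s k ∎
  where
  n = k + 2 + p
  m = suc p
  σ = fac s *ℚ fac (k + m ∸ s)
  a = (fac k *ℚ fac m) *ℚ ℕ→ℚ (suc s)
  j+j≤k : ∀ {j} → j ≤ ⌊ k /2⌋ → j + j ≤ k
  j+j≤k j≤k/2 = ℕ.≤-trans (ℕ.+-mono-≤ j≤k/2 (ℕ.≤-trans j≤k/2 (ℕ.⌊n/2⌋≤⌈n/2⌉ k)))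
    (ℕ.≤-reflexive (ℕ.⌊n/2⌋+⌈n/2⌉≡n k))

theorem-k+2+p : ∀ k p s → let n = k + 2 + p; r = suc s in
    (ℕ→ℚ (k + 1) ÷' ℕ→ℚ (n ∸ k ∸ 1)) *ℚ sum-A n k r
    ≡ (ℕ→ℚ (k + 1) ÷' ℕ→ℚ r) *ℚ sum-B n k r
-- `μ` and `ρ` clear the denominators n - k - 1 and r of the prefactors, and `σ` is the factor
-- required by the closed forms of both sums.
theorem-k+2+p k p s = *-cancelʳ-≡ (μ *ℚ ρ *ℚ σ) (*-≢0 (*-≢0 (ℕ→ℚ-suc≢0 p) (ℕ→ℚ-suc≢0 s)) σ≢0) (begin
  (κ ÷' ℕ→ℚ (n′ ∸ k ∸ 1)) *ℚ SA *ℚ (μ *ℚ ρ *ℚ σ)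
    ≡⟨ cong (λ d → (κ ÷' ℕ→ℚ d) *ℚ SA *ℚ (μ *ℚ ρ *ℚ σ)) (cong (ℕ._∸ 1) (n∸k k p)) ⟩
  (κ ÷' μ) *ℚ SA *ℚ (μ *ℚ ρ *ℚ σ)
    ≡⟨ collectˡ (κ ÷' μ) SA μ ρ σ ⟩
  (κ ÷' μ *ℚ μ) *ℚ ρ *ℚ (σ *ℚ SA)
    ≡⟨ cong₂ (λ y z → y *ℚ ρ *ℚ z) (÷'-* κ (ℕ→ℚ-suc≢0 p)) (sum-A-closed k p s) ⟩
  κ *ℚ ρ *ℚ (a *ℚ A m s k)
    ≡⟨ cong (λ z → κ *ℚ ρ *ℚ (a *ℚ z)) (A≗B m s k) ⟩
  κ *ℚ ρ *ℚ (a *ℚ B m s k)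
    ≡⟨ swap κ ρ a (B m s k) ⟩
  κ *ℚ (a *ℚ ρ *ℚ B m s k)
    ≡⟨ cong₂ _*ℚ_ (÷'-* κ (ℕ→ℚ-suc≢0 s)) (sum-B-closed k p s) ⟨
  (κ ÷' ρ *ℚ ρ) *ℚ (μ *ℚ (σ *ℚ SB))
    ≡⟨ collectʳ (κ ÷' ρ) SB μ ρ σ ⟩
  (κ ÷' ρ) *ℚ SB *ℚ (μ *ℚ ρ *ℚ σ) ∎)
  where
  n′ = k + 2 + p
  m = suc p
  μ = ℕ→ℚ m
  ρ = ℕ→ℚ (suc s)
  κ = ℕ→ℚ (k + 1)
  σ = fac s *ℚ fac (k + m ∸ s)
  a = fac k *ℚ fac m
  SA = sum-A n′ k (suc s)
  SB = sum-B n′ k (suc s)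
  σ≢0 : σ ≢ 0ℚ
  σ≢0 = *-≢0 (fac≢0 s) (fac≢0 (k + m ∸ s))
  collectˡ : ∀ u S μ ρ σ → u *ℚ S *ℚ (μ *ℚ ρ *ℚ σ) ≡ (u *ℚ μ) *ℚ ρ *ℚ (σ *ℚ S)
  collectˡ = solve-∀ ℚ-ring
  swap : ∀ κ ρ a b → κ *ℚ ρ *ℚ (a *ℚ b) ≡ κ *ℚ (a *ℚ ρ *ℚ b)
  swap = solve-∀ ℚ-ring
  collectʳ : ∀ v S μ ρ σ → (v *ℚ ρ) *ℚ (μ *ℚ (σ *ℚ S)) ≡ v *ℚ S *ℚ (μ *ℚ ρ *ℚ σ)
  collectʳ = solve-∀ ℚ-ring

theorem1 : (n k r : ℕ) → k + 2 ≤ n → 1 ≤ r →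
  (ℕ→ℚ (k + 1) ÷' ℕ→ℚ (n ∸ k ∸ 1)) *ℚ
    sumTo k (λ i → binom k (+ i) *ℚ binom (n ∸ k + i ∸ 1) (+ r)
                     *ℚ binom (n ∸ i ∸ 1) (+ n -ℤ + r))
  ≡
  (ℕ→ℚ (k + 1) ÷' ℕ→ℚ r) *ℚ
    sumTo ⌊ k /2⌋ (λ j → sgn j *ℚ
      ((binom k (+ j) *ℚ binom (k ∸ j) (+ j) *ℚ binom (n ∸ j ∸ 2) (+ r -ℤ + 1)
         *ℚ binom (n ∸ j ∸ 1) (+ r -ℤ + j -ℤ + 1))
       ÷' binom (n ∸ j ∸ 2) (+ j)))
theorem1 n k (suc s) k+2≤n _ =
  -- The bound k + 2 ≤ n lets n be rewritten as k + 2 + p with p = n - k - 2.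
  subst (λ n → (ℕ→ℚ (k + 1) ÷' ℕ→ℚ (n ∸ k ∸ 1)) *ℚ sum-A n k (suc s)
           ≡ (ℕ→ℚ (k + 1) ÷' ℕ→ℚ (suc s)) *ℚ sum-B n k (suc s))
    (ℕ.m+[n∸m]≡n k+2≤n) (theorem-k+2+p k (n ∸ (k + 2)) s)
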